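{- Let $G$ be a plane elementary bipartite graph (with a fixed proper black–white vertex coloring). Then the finite distributive lattice $\mathbf{M}(G)$ is irreducible, i.e. it is not isomorphic to a direct (cartesian) product of two or more finite distributive lattices each having more than one element.
   Context: A 1-factor of a graph is a perfect matching; $\mathcal{M}(G)$ denotes the set of 1-factors of $G$. A plane bipartite graph $G$ is elementary if it is connected and every edge lies in some 1-factor. Fix a proper 2-coloring (white/black) of $G$. For $M\in\mathcal{M}(G)$, a cycle $C$ is $M$-alternating if its edges are alternately in and not in $M$; it is proper (resp. improper) $M$-alternating if every edge of $C$ in $M$ goes from its white (resp. black) end-vertex to its black (resp. white) end-vertex when $C$ is traversed clockwise. The $Z$-transformation digraph $\vec Z(G)$ has vertex set $\mathcal{M}(G)$ and an arc from $M_1$ to $M_2$ whenever $M_1\oplus M_2$ is the boundary of an inner face of $G$ which is a proper $M_1$-alternating (and improper $M_2$-alternating) cycle. $\mathbf{M}(G)$ is the poset on $\mathcal{M}(G)$ with $M_1\preceq M_2$ iff $\vec Z(G)$ has a directed path from $M_2$ to $M_1$. For elementary $G$ it is known that $\mathbf{M}(G)$ is a finite distributive lattice whose Hasse diagram is $\vec Z(G)$. -}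

module Defs where

open import Data.Nat using (ℕ; zero; suc; _+_; _*_)
open import Data.Fin using (Fin)
open import Data.Bool using (Bool; true; false; _xor_)
open import Data.Vec using (Vec; lookup)
open import Data.Product using (Σ; ∃; ∃-syntax; _×_; _,_; proj₁; proj₂)
open import Relation.Binary.PropositionalEquality using (_≡_; _≢_)
open import Relation.Binary.Construct.Closure.ReflexiveTransitive using (Star)
open import Relation.Binary.Lattice.Bundles using (DistributiveLattice)
open import Relation.Nullary using (¬_)
open import Data.Sum using (_⊎_)
open import Level using (0ℓ)

iter : {A : Set} → (A → A) → ℕ → A → A
iter f zero    x = x
iter f (suc k) x = f (iter f k x)

SameOrbit : {A : Set} → (A → A) → A → A → Set
SameOrbit f x y = ∃[ k ] (iter f k x ≡ y)

-- Plane bipartite graphs, encoded as (genus-0) combinatorial maps.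
--
-- Darts (half-edges) are Fin nD; every edge {d , α d} consists of two
-- darts; dart d starts at vertex (vert d) and ends at vert (α d).
-- σ is the rotation: σ d is the next dart around the vertex vert d in
-- COUNTERCLOCKWISE order. The faces are the orbits of φ = σ ∘ α; with
-- this convention the boundary of every inner face is traversed
-- CLOCKWISE by φ (the face lies to the right of each dart d ↦ φ d).
-- Genus 0 (the map lives on the sphere) is expressed by Euler's formula
-- for connected maps; a designated outer face turns the sphere embedding
-- into a plane embedding.

record PlaneBipartiteGraph : Set where
  field
    nV nE nF : ℕ
    α     : Fin (2 * nE) → Fin (2 * nE)
    α-inv : ∀ d → α (α d) ≡ d
    α-fix : ∀ d → α d ≢ d
    σ     : Fin (2 * nE) → Fin (2 * nE)
    σ⁻¹   : Fin (2 * nE) → Fin (2 * nE)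
    σσ⁻¹  : ∀ d → σ (σ⁻¹ d) ≡ d
    σ⁻¹σ  : ∀ d → σ⁻¹ (σ d) ≡ d
    vert        : Fin (2 * nE) → Fin nV
    vert-σ      : ∀ d → vert (σ d) ≡ vert d
    vert-orbit  : ∀ d d' → vert d ≡ vert d' → SameOrbit σ d d'
    vert-onto   : ∀ v → ∃[ d ] (vert d ≡ v)
    no-loop     : ∀ d → vert d ≢ vert (α d)
    no-multi    : ∀ d d' → vert d ≡ vert d' → vert (α d) ≡ vert (α d') → d ≡ d'
    face        : Fin (2 * nE) → Fin nF
    face-φ      : ∀ d → face (σ (α d)) ≡ face d
    face-orbit  : ∀ d d' → face d ≡ face d' → SameOrbit (λ x → σ (α x)) d d'
    face-onto   : ∀ f → ∃[ d ] (face d ≡ f)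
    euler       : nV + nF ≡ nE + 2
    outer       : Fin nF
    white       : Fin nV → Bool
    proper      : ∀ d → white (vert d) ≢ white (vert (α d))

module _ (G : PlaneBipartiteGraph) where
  open PlaneBipartiteGraph G

  Dart : Set
  Dart = Fin (2 * nE)

  φ : Dart → Dart
  φ d = σ (α d)

  Adj : Fin nV → Fin nV → Set
  Adj v w = ∃[ d ] (vert d ≡ v × vert (α d) ≡ w)

  Connected : Set
  Connected = ∀ v w → Star Adj v w

  -- an edge set, given by the dart-indexed vector of membership bits
  -- (closed under α, i.e. a set of edges)
  EdgeSet : Set
  EdgeSet = Vec Bool (2 * nE)

  IsPerfectMatching : EdgeSet → Set
  IsPerfectMatching M =
    (∀ d → lookup M (α d) ≡ lookup M d) ×
    (∀ v → ∃[ d ] (vert d ≡ v × lookup M d ≡ true ×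
                   (∀ d' → vert d' ≡ v → lookup M d' ≡ true → d' ≡ d)))

  PerfectMatching : Set
  PerfectMatching = Σ EdgeSet IsPerfectMatching

  Elementary : Set
  Elementary = Connected × (∀ d → ∃[ M ] (IsPerfectMatching M × lookup M d ≡ true))

  -- the boundary walk of face f (the φ-orbit of f) is a cycle:
  -- no vertex is visited twice and no edge is traversed twice
  IsCycleFace : Fin nF → Set
  IsCycleFace f =
    (∀ d d' → face d ≡ f → face d' ≡ f → vert d ≡ vert d' → d ≡ d') ×
    (∀ d → face d ≡ f → face (α d) ≢ f)

  IsAlternatingFace : EdgeSet → Fin nF → Set
  IsAlternatingFace M f =
    IsCycleFace f × (∀ d → face d ≡ f → (lookup M d xor lookup M (φ d)) ≡ true)

  -- proper M-alternating: each M-edge goes from white to black clockwise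
  IsProperAltFace : EdgeSet → Fin nF → Set
  IsProperAltFace M f =
    IsAlternatingFace M f ×
    (∀ d → face d ≡ f → lookup M d ≡ true → white (vert d) ≡ true)

  -- improper M-alternating: each M-edge goes from black to white clockwise
  IsImproperAltFace : EdgeSet → Fin nF → Set
  IsImproperAltFace M f =
    IsAlternatingFace M f ×
    (∀ d → face d ≡ f → lookup M d ≡ true → white (vert d) ≡ false)

  SymDiffIsBoundary : EdgeSet → EdgeSet → Fin nF → Set
  SymDiffIsBoundary M₁ M₂ f =
    ∀ d → ((lookup M₁ d xor lookup M₂ d) ≡ true → (face d ≡ f ⊎ face (α d) ≡ f)) ×
          ((face d ≡ f ⊎ face (α d) ≡ f) → (lookup M₁ d xor lookup M₂ d) ≡ true)

  ZArc : EdgeSet → EdgeSet → Set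
  ZArc M₁ M₂ =
    IsPerfectMatching M₁ × IsPerfectMatching M₂ ×
    ∃[ f ] (f ≢ outer × SymDiffIsBoundary M₁ M₂ f ×
            IsProperAltFace M₁ f × IsImproperAltFace M₂ f)

  _⪯_ : PerfectMatching → PerfectMatching → Set
  M₁ ⪯ M₂ = Star ZArc (proj₁ M₂) (proj₁ M₁)

module _ (L : DistributiveLattice 0ℓ 0ℓ 0ℓ) where
  open DistributiveLattice L

  FiniteLattice : Set
  FiniteLattice = ∃[ n ] Σ (Fin n → Carrier) (λ e → ∀ x → ∃[ i ] (e i ≈ x))

  NontrivialLattice : Set
  NontrivialLattice = ∃[ x ] ∃[ y ] (¬ (x ≈ y))

-- an order isomorphism between 𝐌(G) and the direct product L₁ × L₂
-- (with componentwise order); for lattices, order isomorphisms are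
-- exactly lattice isomorphisms
record IsoToProduct (G : PlaneBipartiteGraph)
                    (L₁ L₂ : DistributiveLattice 0ℓ 0ℓ 0ℓ) : Set where
  module A = DistributiveLattice L₁
  module B = DistributiveLattice L₂
  field
    to      : PerfectMatching G → A.Carrier × B.Carrier
    from    : A.Carrier × B.Carrier → PerfectMatching G
    from∘to : ∀ M → proj₁ (from (to M)) ≡ proj₁ M
    to∘from : ∀ p → (proj₁ (to (from p)) A.≈ proj₁ p) × (proj₂ (to (from p)) B.≈ proj₂ p)
    to-mono : ∀ M N → _⪯_ G M N →
                (proj₁ (to M) A.≤ proj₁ (to N)) × (proj₂ (to M) B.≤ proj₂ (to N))
    to-refl : ∀ M N → (proj₁ (to M) A.≤ proj₁ (to N)) × (proj₂ (to M) B.≤ proj₂ (to N)) →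
                _⪯_ G M N

-- 𝐌(G) is irreducible: it is not isomorphic to a direct product of two
-- finite distributive lattices each having more than one element
-- (a product of k ≥ 2 such factors is a product of two such factors).
MIrreducible : PlaneBipartiteGraph → Set₁
MIrreducible G =
  ∀ (L₁ L₂ : DistributiveLattice 0ℓ 0ℓ 0ℓ) →
    FiniteLattice L₁ → NontrivialLattice L₁ →
    FiniteLattice L₂ → NontrivialLattice L₂ →
    ¬ IsoToProduct G L₁ L₂

{-# OPTIONS --safe #-}
-- Along a directed path of Z(G) the number of flips of each inner face is
-- determined by the two end matchings: the difference of two such counts is the
-- same on both sides of every edge, and it vanishes on the outer face. Hence arcs are covers,
-- and in a product L₁ × L₂ opposite sides of a square of covers flip the same
-- face. So for a fixed edge the membership bit B(a , b) satisfies
-- B(a , b) + B(a′ , b′) = B(a , b′) + B(a′ , b); being 0/1-valued, it depends on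
-- one coordinate only. Two edges at a common vertex cannot depend on different
-- coordinates, since choosing the coordinates independently would put both into
-- one matching. By connectedness all edges depend on the same coordinate, and
-- the other factor is trivial.
module Submission where

open import Defs

open import Data.Bool using (Bool; true; false; _xor_)
import Data.Bool.Properties as Bool
open import Data.Empty using (⊥-elim)
open import Data.Fin using (Fin; _≟_)
open import Data.Fin.Properties using (¬∀⟶∃¬)
open import Data.Nat using (ℕ; zero; suc; _+_)
open import Data.Nat.Properties using (+-comm; +-assoc; +-cancelˡ-≡; +-cancelʳ-≡; m+n≡0⇒m≡0)
open import Data.Nat.Tactic.RingSolver using (solve-∀)
open import Data.Product using (∃-syntax; _×_; _,_; proj₁; proj₂; swap)
open import Data.Sum using (_⊎_; inj₁; inj₂; [_,_])
open import Data.Vec using (Vec; lookup)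
open import Data.Vec.Properties using (tabulate∘lookup; tabulate-cong)
open import Level using (0ℓ)
open import Relation.Binary.Construct.Closure.ReflexiveTransitive as Star using (Star; ε; _◅_; _◅◅_)
open import Relation.Binary.Lattice.Bundles using (DistributiveLattice)
open import Relation.Binary.PropositionalEquality using (_≡_; _≢_; refl; sym; trans; cong; cong₂; subst; module ≡-Reasoning)
open import Relation.Nullary using (¬_; yes; no; contradiction)

-- Bits, Kronecker deltas and subtraction-free differences.

bit : Bool → ℕ
bit false = 0
bit true  = 1

bit-injective : ∀ {x y} → bit x ≡ bit y → x ≡ y
bit-injective {false} {false} _ = refl
bit-injective {true}  {true}  _ = refl

xor-injectiveʳ : ∀ x {y z} → x xor y ≡ x xor z → y ≡ z
xor-injectiveʳ false eq = eq
xor-injectiveʳ true  eq = Bool.not-injective eq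

xor≢true⇒≡ : ∀ x y → x xor y ≢ true → x ≡ y
xor≢true⇒≡ false false _ = refl
xor≢true⇒≡ false true  h = contradiction refl h
xor≢true⇒≡ true  false h = contradiction refl h
xor≢true⇒≡ true  true  _ = refl

lookup-injective : ∀ {A : Set} {n} {xs ys : Vec A n} →
                   (∀ i → lookup xs i ≡ lookup ys i) → xs ≡ ys
lookup-injective {xs = xs} {ys} eq =
  trans (sym (tabulate∘lookup xs)) (trans (tabulate-cong eq) (tabulate∘lookup ys))

δ : ∀ {n} → Fin n → Fin n → ℕ
δ f g with f ≟ g
... | yes _ = 1
... | no  _ = 0

δ-refl : ∀ {n} (f : Fin n) → δ f f ≡ 1
δ-refl f with f ≟ f
... | yes _  = refl
... | no f≢f = contradiction refl f≢f

δ-≢ : ∀ {n} {f g : Fin n} → f ≢ g → δ f g ≡ 0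
δ-≢ {f = f} {g} f≢g with f ≟ g
... | yes f≡g = contradiction f≡g f≢g
... | no  _   = refl

δ≡suc⇒≡ : ∀ {n k} (f g : Fin n) → δ f g ≡ suc k → f ≡ g
δ≡suc⇒≡ f g eq with f ≟ g
... | yes f≡g = f≡g

δ≢2+ : ∀ {n k} (f g : Fin n) → δ f g ≢ suc (suc k)
δ≢2+ f g eq with f ≟ g
δ≢2+ f g () | yes _
δ≢2+ f g () | no _

-- The 2 × 2 arrays (p q / r s) with p − q = r − s.
record Balanced (p q r s : ℕ) : Set where
  constructor balanced
  field cross : p + s ≡ q + r

open Balanced

balanced-paste : ∀ {p q r s t u} → Balanced p q r s → Balanced r s t u → Balanced p q t u
balanced-paste {p} {q} {r} {s} {t} {u} (balanced h) (balanced k) =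
  -- Adding the two cross equations leaves `s + r` on both sides; cancelling it replaces chaining
  -- differences, which could be negative.
  balanced (+-cancelʳ-≡ (s + r) (p + u) (q + t) (begin
    (p + u) + (s + r)  ≡⟨ regroup₁ p u s r ⟩
    (p + s) + (r + u)  ≡⟨ cong₂ _+_ h k ⟩
    (q + r) + (s + t)  ≡⟨ regroup₂ q r s t ⟩
    (q + t) + (s + r)  ∎))
  where
  open ≡-Reasoning
  regroup₁ : ∀ p u s r → (p + u) + (s + r) ≡ (p + s) + (r + u)
  regroup₁ = solve-∀
  regroup₂ : ∀ q r s t → (q + r) + (s + t) ≡ (q + t) + (s + r)
  regroup₂ = solve-∀

balanced-transpose : ∀ {p q r s} → Balanced p q r s → Balanced p r q s
balanced-transpose {q = q} {r} (balanced h) = balanced (trans h (+-comm q r))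

balanced-mirror : ∀ {p q r s} → Balanced p q r s → Balanced q p s r
balanced-mirror (balanced h) = balanced (sym h)

balanced-flip : ∀ {p q r s} → Balanced p q r s → Balanced r s p q
balanced-flip {p} {q} {r} {s} (balanced h) =
  balanced (trans (+-comm r q) (trans (sym h) (+-comm p s)))

uncons : ∀ {A : Set} {R : A → A → Set} {x z} → Star R x z → x ≡ z ⊎ ∃[ y ] (R x y × Star R y z)
uncons ε       = inj₁ refl
uncons (r ◅ P) = inj₂ (_ , r , P)

-- ZArc G M N unfolds to a type from which M and N cannot be inferred.
record Arc (G : PlaneBipartiteGraph) (M N : EdgeSet G) : Set where
  constructor arc
  field zarc : ZArc G M N

open Arc

-- Flip counts along directed paths.

module _ {G : PlaneBipartiteGraph} where
  open PlaneBipartiteGraph G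

  label : ∀ {M N} → Arc G M N → Fin nF
  label (arc (_ , _ , f , _)) = f

  flips : ∀ {M N} → Star (Arc G) M N → Fin nF → ℕ
  flips ε       h = 0
  flips (e ◅ P) h = δ (label e) h + flips P h

  flips-◅◅ : ∀ {M N K} (P : Star (Arc G) M N) (Q : Star (Arc G) N K) h →
             flips (P ◅◅ Q) h ≡ flips P h + flips Q h
  flips-◅◅ ε       Q h = refl
  flips-◅◅ (e ◅ P) Q h =
    trans (cong (δ (label e) h +_) (flips-◅◅ P Q h))
          (sym (+-assoc (δ (label e) h) _ _))

  flips-outer : ∀ {M N} (P : Star (Arc G) M N) → flips P outer ≡ 0
  flips-outer ε = refl
  flips-outer (arc (_ , _ , _ , f≢o , _) ◅ P) = cong₂ _+_ (δ-≢ f≢o) (flips-outer P)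

  -- A flip of f removes its edges leaving white clockwise and adds the others.
  arc-balance : ∀ {M N} (e : Arc G M N) d → white (vert d) ≡ true →
                Balanced (bit (lookup N d)) (bit (lookup M d))
                         (δ (label e) (face (α d))) (δ (label e) (face d))
  arc-balance (arc (_ , _ , f , _)) d w
    with f ≟ face d | f ≟ face (α d)
  -- An edge cannot have `f` on both sides, because the boundary of `f` is a cycle.
  arc-balance (arc (_ , _ , _ , _ , _ , (((_ , simple) , _) , _) , _)) d w
    | yes p | yes q = contradiction (sym q) (simple d (sym p))
  arc-balance {M} {N} (arc (_ , _ , _ , _ , sd , _ , (_ , improper))) d w | yes p | no _
    with lookup M d | lookup N d | proj₂ (sd d) (inj₁ (sym p)) | improper d (sym p)
  ... | true  | false | _ | _ = balanced refl
  ... | false | true  | _ | i = contradiction (trans (sym w) (i refl)) λ ()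
  arc-balance {M} {N} (arc ((Mα , _) , _ , _ , _ , sd , (_ , prop) , _)) d w | no _ | yes q
    with lookup M d | lookup N d | proj₂ (sd d) (inj₂ (sym q)) | prop (α d) (sym q) | Mα d
  ... | false | true  | _ | _ | _ = balanced refl
  ... | true  | false | _ | i | m = contradiction (trans w (sym (i m))) (proper d)
  arc-balance {M} {N} (arc (_ , _ , _ , _ , sd , _)) d w | no p | no q =
    balanced (cong (λ x → bit x + 0) (sym (xor≢true⇒≡ (lookup M d) (lookup N d)
      λ x → [ (λ e → p (sym e)) , (λ e → q (sym e)) ] (proj₁ (sd d) x))))

  -- The arc balances telescope: bits of intermediate matchings cancel and only the two ends remain.
  path-balance : ∀ {M N} (P : Star (Arc G) M N) d → white (vert d) ≡ true →
                 Balanced (bit (lookup N d)) (bit (lookup M d))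
                          (flips P (face (α d))) (flips P (face d))
  path-balance ε d w = balanced refl
  path-balance {M} {N} (_◅_ {j = K} e P) d w =
    balanced (add {bit (lookup N d)} {bit (lookup K d)} {bit (lookup M d)}
                  (cross (path-balance P d w)) (cross (arc-balance e d w)))
    where
    add : ∀ {n k m x y x′ y′} → n + y ≡ k + x → k + y′ ≡ m + x′ →
          n + (y′ + y) ≡ m + (x′ + x)
    add {n} {k} {m} {x} {y} {x′} {y′} h h′ = begin
      n + (y′ + y)  ≡⟨ s₁ n y′ y ⟩
      (n + y) + y′  ≡⟨ cong (_+ y′) h ⟩
      (k + x) + y′  ≡⟨ s₂ k x y′ ⟩
      (k + y′) + x  ≡⟨ cong (_+ x) h′ ⟩
      (m + x′) + x  ≡⟨ +-assoc m x′ x ⟩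
      m + (x′ + x)  ∎
      where
      open ≡-Reasoning
      s₁ : ∀ n y′ y → n + (y′ + y) ≡ (n + y) + y′
      s₁ = solve-∀
      s₂ : ∀ k x y′ → (k + x) + y′ ≡ (k + y′) + x
      s₂ = solve-∀

  black⇒white-α : ∀ d → white (vert d) ≡ false → white (vert (α d)) ≡ true
  black⇒white-α d b with white (vert (α d)) | proper d
  ... | true  | _ = refl
  ... | false | n = contradiction b n

  label-injective : ∀ {M N N′} (e : Arc G M N) (e′ : Arc G M N′) →
                    label e ≡ label e′ → N ≡ N′
  label-injective {M} {N} {N′} (arc (_ , _ , f , _ , sd , _)) (arc (_ , _ , .f , _ , sd′ , _)) refl =
    lookup-injective λ d → xor-injectiveʳ (lookup M d) (same d)
    where
    same : ∀ d → lookup M d xor lookup N d ≡ lookup M d xor lookup N′ d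
    same d with lookup M d xor lookup N d | lookup M d xor lookup N′ d | sd d | sd′ d
    ... | true  | true  | _       | _        = refl
    ... | false | false | _       | _        = refl
    ... | true  | false | p , _   | _ , q    = sym (q (p refl))
    ... | false | true  | _ , q   | p , _    = q (p refl)

-- Uniqueness of flip counts, covers and squares.

module _ {G : PlaneBipartiteGraph} (connected : Connected G) where
  open PlaneBipartiteGraph G

  vertex-induction : (Q : Dart G → Set) → (∀ d → Q d → Q (α d)) →
                     (∀ d d′ → vert d ≡ vert d′ → Q d → Q d′) →
                     ∀ d d′ → Q d → Q d′
  vertex-induction Q Qα Qv d d′ q = go (connected (vert d) (vert d′)) refl q refl
    where
    go : ∀ {v w} → Star (Adj G) v w → ∀ {d} → vert d ≡ v → Q d → vert d′ ≡ w → Q d′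
    go ε                      {d} dv q d′w = Qv d d′ (trans dv (sym d′w)) q
    go ((c , cv , cw) ◅ path) {d} dv q d′w =
      go path cw (Qα c (Qv d c (trans dv (sym cv)) q)) d′w

  dart-induction : (Q : Dart G → Set) → (∀ d → Q d → Q (α d)) → (∀ d → Q d → Q (σ d)) →
                   ∀ d d′ → Q d → Q d′
  dart-induction Q Qα Qσ = vertex-induction Q Qα λ d d′ eq q →
    let (k , kd) = vert-orbit d d′ eq in subst Q kd (along k d q)
    where
    along : ∀ k d → Q d → Q (iter σ k d)
    along zero    d q = q
    along (suc k) d q = Qσ _ (along k d q)

  -- Both counts vanish on the outer face, and agreement on one side of an edge passes to the other.
  -- Since `α` and `σ` reach every dart, agreement spreads to every face.
  flips-unique : ∀ {M N} (P Q : Star (Arc G) M N) h → flips P h ≡ flips Q h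
  flips-unique {M} {N} P Q h with face-onto outer | face-onto h
  ... | o , refl | d , refl =
    dart-induction Agree agree-α agree-σ o d (trans (flips-outer P) (sym (flips-outer Q)))
    where
    Agree : Dart G → Set
    Agree d = flips P (face d) ≡ flips Q (face d)

    balance : ∀ d → Balanced (flips P (face (α d))) (flips P (face d))
                              (flips Q (face (α d))) (flips Q (face d))
    balance d with white (vert d) in w
    -- The row of bits depends only on `M` and `N`, so it is common to both paths and pasting
    -- eliminates it.
    ... | true  = balanced-paste (balanced-flip (path-balance P d w)) (path-balance Q d w)
    ... | false with path-balance P (α d) (black⇒white-α {G} d w) | path-balance Q (α d) (black⇒white-α {G} d w)
    ...   | p | q rewrite α-inv d =
      balanced-mirror (balanced-paste (balanced-flip p) q)

    agree-α : ∀ d → Agree d → Agree (α d)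
    agree-α d eq = +-cancelʳ-≡ (flips Q (face d)) _ _
      (trans (cross (balance d)) (trans (cong (_+ flips Q (face (α d))) eq) (+-comm (flips Q (face d)) _)))

    agree-σ : ∀ d → Agree d → Agree (σ d)
    -- `σ d` and `α d` lie on the same face, so rotating is again a crossing of the edge of `d`.
    agree-σ d eq = subst (λ f → flips P f ≡ flips Q f) faceσ (agree-α d eq)
      where
      faceσ : face (α d) ≡ face (σ d)
      faceσ = trans (sym (face-φ (α d))) (cong (λ x → face (σ x)) (α-inv d))

  flips≡0⇒≡ : ∀ {M N} (P : Star (Arc G) M N) → (∀ h → flips P h ≡ 0) → M ≡ N
  flips≡0⇒≡ ε       _ = refl
  flips≡0⇒≡ (e ◅ P) z =
    contradiction (trans (sym (δ-refl (label e))) (m+n≡0⇒m≡0 _ (z (label e)))) λ ()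

  -- The closed path has the same counts as the empty one, so nothing is ever flipped.
  path-antisym : ∀ {M N} → Star (Arc G) M N → Star (Arc G) N M → M ≡ N
  path-antisym P Q = flips≡0⇒≡ P λ h →
    m+n≡0⇒m≡0 _ (trans (sym (flips-◅◅ P Q h)) (flips-unique (P ◅◅ Q) ε h))

  arc-irreflexive : ∀ {M N} → Arc G M N → M ≢ N
  arc-irreflexive e refl =
    contradiction (trans (sym (cong (_+ 0) (δ-refl (label e)))) (flips-unique (e ◅ ε) ε (label e))) λ ()

  -- If both halves were nonempty, each would start with a flip of `label e`, the only face that `e`
  -- flips; that face would then be counted twice instead of once.
  arc-covers : ∀ {M K N} → Arc G M N → Star (Arc G) M K → Star (Arc G) K N → K ≡ M ⊎ K ≡ N
  arc-covers e ε        Q        = inj₁ refl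
  arc-covers e (_ ◅ _)  ε        = inj₂ refl
  arc-covers e (e₁ ◅ P) (e₂ ◅ Q) = ⊥-elim (δ≢2+ (label e) f₁ (trans (sym (count f₁)) two))
    where
    f₁ f₂ : Fin nF
    f₁ = label e₁
    f₂ = label e₂

    rest : Fin nF → ℕ
    rest h = flips P h + flips Q h

    regroup : ∀ a b p q → a + (b + (p + q)) ≡ (a + p) + (b + q)
    regroup = solve-∀

    count : ∀ h → δ f₁ h + (δ f₂ h + rest h) ≡ δ (label e) h
    count h = begin
      δ f₁ h + (δ f₂ h + rest h)             ≡⟨ regroup (δ f₁ h) (δ f₂ h) (flips P h) (flips Q h) ⟩
      flips (e₁ ◅ P) h + flips (e₂ ◅ Q) h    ≡⟨ sym (flips-◅◅ (e₁ ◅ P) (e₂ ◅ Q) h) ⟩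
      flips ((e₁ ◅ P) ◅◅ (e₂ ◅ Q)) h         ≡⟨ flips-unique ((e₁ ◅ P) ◅◅ (e₂ ◅ Q)) (e ◅ ε) h ⟩
      δ (label e) h + 0                      ≡⟨ +-comm (δ (label e) h) 0 ⟩
      δ (label e) h                          ∎
      where open ≡-Reasoning

    e≡f₁ : label e ≡ f₁
    e≡f₁ = δ≡suc⇒≡ (label e) f₁
      (trans (sym (count f₁)) (cong (_+ (δ f₂ f₁ + rest f₁)) (δ-refl f₁)))

    e≡f₂ : label e ≡ f₂
    e≡f₂ = δ≡suc⇒≡ (label e) f₂ (trans (sym (count f₂))
      (trans (cong (λ x → δ f₁ f₂ + (x + rest f₂)) (δ-refl f₂)) (+-comm (δ f₁ f₂) _)))

    two : δ f₁ f₁ + (δ f₂ f₁ + rest f₁) ≡ 2 + rest f₁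
    two = cong₂ (λ x y → x + (y + rest f₁)) (δ-refl f₁)
      (trans (cong (λ f → δ f f₁) (trans (sym e≡f₂) e≡f₁)) (δ-refl f₁))

  -- The route through `N` flips `label e`, hence so does the route through `N′`. The arc `e′`
  -- cannot do it, as it would then end in `N`; so `k` does.
  square-label : ∀ {M N N′ K} (e : Arc G M N) (e′ : Arc G M N′)
                 (h : Arc G N K) (k : Arc G N′ K) → N ≢ N′ → label k ≡ label e
  square-label e e′ h k N≢N′ = δ≡suc⇒≡ (label k) (label e) (begin
    δ (label k) (label e)        ≡⟨ +-comm 0 _ ⟩
    δ (label k) (label e) + 0    ≡⟨ cong (_+ (δ (label k) (label e) + 0)) (sym (δ-≢ e′≢e)) ⟩
    flips (e′ ◅ k ◅ ε) (label e) ≡⟨ flips-unique (e′ ◅ k ◅ ε) (e ◅ h ◅ ε) (label e) ⟩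
    flips (e ◅ h ◅ ε) (label e)  ≡⟨ cong (_+ (δ (label h) (label e) + 0)) (δ-refl (label e)) ⟩
    suc (δ (label h) (label e) + 0) ∎)
    where
    open ≡-Reasoning
    e′≢e : label e′ ≢ label e
    e′≢e eq = N≢N′ (label-injective e e′ (sym eq))

-- Product coordinates on the matchings.

swapIso : ∀ {G L₁ L₂} → IsoToProduct G L₁ L₂ → IsoToProduct G L₂ L₁
swapIso I = record
  { to      = λ M → swap (to M)
  ; from    = λ p → from (swap p)
  ; from∘to = from∘to
  ; to∘from = λ p → swap (to∘from (swap p))
  ; to-mono = λ M N le → swap (to-mono M N le)
  ; to-refl = λ M N le → to-refl M N (swap le)
  }
  where open IsoToProduct I

module Product (G : PlaneBipartiteGraph) (connected : Connected G)
               {L₁ L₂ : DistributiveLattice 0ℓ 0ℓ 0ℓ} (I : IsoToProduct G L₁ L₂) where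
  open PlaneBipartiteGraph G
  open IsoToProduct I

  F : A.Carrier → B.Carrier → EdgeSet G
  F a b = proj₁ (from (a , b))

  -- Directed paths descend in the order, so the larger pair is the source.
  F-mono : ∀ {a a′ b b′} → a′ A.≤ a → b′ B.≤ b → Star (Arc G) (F a b) (F a′ b′)
  F-mono {a} {a′} {b} {b′} p q = Star.map arc (to-refl (from (a′ , b′)) (from (a , b))
    ( A.trans (A.reflexive (proj₁ (to∘from (a′ , b′)))) (A.trans p (A.reflexive (A.Eq.sym (proj₁ (to∘from (a , b))))))
    , B.trans (B.reflexive (proj₂ (to∘from (a′ , b′)))) (B.trans q (B.reflexive (B.Eq.sym (proj₂ (to∘from (a , b)))))) ))

  -- Equivalent coordinates are joined by directed paths both ways, and these force equal ends.
  F-cong : ∀ {a a′ b b′} → a A.≈ a′ → b B.≈ b′ → F a b ≡ F a′ b′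
  F-cong p q = path-antisym connected
    (F-mono (A.reflexive (A.Eq.sym p)) (B.reflexive (B.Eq.sym q)))
    (F-mono (A.reflexive p) (B.reflexive q))

  F-reflect : ∀ {a a′ b b′} → Star (Arc G) (F a b) (F a′ b′) → (a′ A.≤ a) × (b′ B.≤ b)
  F-reflect {a} {a′} {b} {b′} P with to-mono (from (a′ , b′)) (from (a , b)) (Star.map zarc P)
  ... | p , q =
      A.trans (A.reflexive (A.Eq.sym (proj₁ (to∘from (a′ , b′))))) (A.trans p (A.reflexive (proj₁ (to∘from (a , b)))))
    , B.trans (B.reflexive (B.Eq.sym (proj₂ (to∘from (a′ , b′))))) (B.trans q (B.reflexive (proj₂ (to∘from (a , b)))))

  F-injective : ∀ {a a′ b b′} → F a b ≡ F a′ b′ → (a A.≈ a′) × (b B.≈ b′)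
  F-injective {a} {a′} {b} {b′} eq
    with F-reflect (subst (Star (Arc G) (F a b)) eq ε)
       | F-reflect (subst (λ X → Star (Arc G) X (F a b)) eq ε)
  ... | p , q | p′ , q′ = A.antisym p′ p , B.antisym q′ q

  F-surjective : ∀ M → IsPerfectMatching G M → ∃[ a ] ∃[ b ] (F a b ≡ M)
  F-surjective M pm = _ , _ , from∘to (M , pm)

  -- The first coordinate of `K` is squeezed between `a` and `a`, so the path stays in one slice.
  slice : ∀ {a b b′ K} → Arc G (F a b) K → Star (Arc G) K (F a b′) →
          ∃[ k ] (b′ B.≤ k × k B.≤ b × F a k ≡ K)
  slice {K = K} e@(arc (_ , pm , _)) P with F-surjective K pm
  ... | c , k , refl with F-reflect (e ◅ ε) | F-reflect P
  ...   | c≤a , k≤b | a≤c , b′≤k = k , b′≤k , k≤b , F-cong (A.antisym a≤c c≤a) B.Eq.refl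

  -- Covering in the second coordinate is the same in every slice. The first arc out of `F a′ b`
  -- towards `F a′ b′` ends at some `F a′ k`; in the slice of `a` the cover `e` leaves only `k ≈ b`,
  -- which would make that arc a loop, or `k ≈ b′`.
  transport : ∀ {a b b′} → b′ B.≤ b → Arc G (F a b) (F a b′) →
              ∀ a′ → Arc G (F a′ b) (F a′ b′)
  transport {a} {b} {b′} b′≤b e a′ with uncons (F-mono {a′} A.refl b′≤b)
  ... | inj₁ eq = contradiction (F-cong A.Eq.refl (proj₂ (F-injective eq))) (arc-irreflexive connected e)
  ... | inj₂ (K , e′ , P) with slice e′ P
  ...   | k , b′≤k , k≤b , refl with arc-covers connected e (F-mono A.refl k≤b) (F-mono A.refl b′≤k)
  ...     | inj₁ eq = contradiction (sym (F-cong A.Eq.refl (proj₂ (F-injective eq)))) (arc-irreflexive connected e′)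
  ...     | inj₂ eq = subst (Arc G (F a′ b)) (F-cong A.Eq.refl (proj₂ (F-injective eq))) e′

  bitAt : Dart G → A.Carrier → B.Carrier → ℕ
  bitAt d a b = bit (lookup (F a b) d)

  BalancedAt : Dart G → A.Carrier → A.Carrier → B.Carrier → B.Carrier → Set
  BalancedAt d a a′ b b′ = Balanced (bitAt d a b) (bitAt d a′ b) (bitAt d a b′) (bitAt d a′ b′)

-- Additivity of membership bits and irreducibility.

module _ (G : PlaneBipartiteGraph) (connected : Connected G)
         {L₁ L₂ : DistributiveLattice 0ℓ 0ℓ 0ℓ} (I : IsoToProduct G L₁ L₂) where
  open PlaneBipartiteGraph G
  open IsoToProduct I using (module A; module B; from)
  open Product G connected I
  -- `Swapped.F b a` reduces to `F a b`, so `slice` and `transport` become available in the first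
  -- coordinate.
  private module Swapped = Product G connected (swapIso I)

  -- Opposite sides `e` and `k` flip the same face, so they change the bit of `d` by the same
  -- amount.
  square-balanced : ∀ {a a′ b b′} → a′ A.≤ a → b′ B.≤ b →
                    Arc G (F a b) (F a′ b) → Arc G (F a b) (F a b′) →
                    ∀ d → white (vert d) ≡ true → BalancedAt d a a′ b b′
  square-balanced {a} {a′} {b} {b′} a′≤a b′≤b e e′ d w =
    balanced-mirror (balanced-paste (arc-balance e d w) (balanced-flip opposite))
    where
    k : Arc G (F a b′) (F a′ b′)
    k = Swapped.transport a′≤a e b′

    F≢ : F a′ b ≢ F a b′
    F≢ eq = arc-irreflexive connected e
      (F-cong (A.Eq.sym (proj₁ (F-injective eq))) B.Eq.refl)

    opposite : Balanced (bitAt d a′ b′) (bitAt d a b′)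
                        (δ (label e) (face (α d))) (δ (label e) (face d))
    opposite = subst (λ f → Balanced (bitAt d a′ b′) (bitAt d a b′) (δ f (face (α d))) (δ f (face d)))
      (square-label connected e e′ (transport b′≤b e′ a′) k F≢) (arc-balance k d w)

  -- Squares are stacked along the path in the second coordinate, with `e` transported to each new
  -- level.
  strip-balanced : ∀ {a a′ b b′} → a′ A.≤ a →
                   Arc G (F a b) (F a′ b) → Star (Arc G) (F a b) (F a b′) →
                   ∀ d → white (vert d) ≡ true → BalancedAt d a a′ b b′
  strip-balanced {a} {a′} {b′ = b′} a′≤a e P d w = go P refl e
    where
    go : ∀ {X b} → Star (Arc G) X (F a b′) → F a b ≡ X → Arc G (F a b) (F a′ b) →
         BalancedAt d a a′ b b′
    go ε eq e rewrite F-cong (A.Eq.refl {a}) (proj₂ (F-injective eq))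
                    | F-cong (A.Eq.refl {a′}) (proj₂ (F-injective eq)) =
      balanced (+-comm (bitAt d a b′) (bitAt d a′ b′))
    go (e′ ◅ P) refl e with slice e′ P
    ... | k , _ , k≤b , refl =
      balanced-paste (square-balanced a′≤a k≤b e e′ d w)
                     (go P refl (Swapped.transport a′≤a e k))

  -- Strips are placed side by side along a path in the first coordinate.
  rectangle-balanced : ∀ {a a′ b b′} → a′ A.≤ a → b′ B.≤ b →
                       ∀ d → white (vert d) ≡ true → BalancedAt d a a′ b b′
  rectangle-balanced {a} {a′} {b} {b′} a′≤a b′≤b d w = go (F-mono a′≤a B.refl) refl
    where
    go : ∀ {X a} → Star (Arc G) X (F a′ b) → F a b ≡ X → BalancedAt d a a′ b b′
    go ε eq rewrite F-cong (proj₁ (F-injective eq)) (B.Eq.refl {b})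
                  | F-cong (proj₁ (F-injective eq)) (B.Eq.refl {b′}) =
      balanced refl
    go (e ◅ P) refl with Swapped.slice e P
    ... | k , _ , k≤a , refl =
      balanced-transpose (balanced-paste
        (balanced-transpose (strip-balanced k≤a e (F-mono A.refl b′≤b) d w))
        (balanced-transpose (go P refl)))

  white-balanced : ∀ d → white (vert d) ≡ true → ∀ a a′ b b′ → BalancedAt d a a′ b b′
  white-balanced d w a a′ b b′ =
    -- Incomparable coordinates are both compared with their join, here `b ∨ b′` and inside `below`
    -- also `a ∨ a′`.
    balanced-paste (balanced-flip (below (B.x≤x∨y b b′))) (below (B.y≤x∨y b b′))
    where
    below : ∀ {b b₀} → b B.≤ b₀ → BalancedAt d a a′ b₀ b
    below b≤b₀ = balanced-transpose (balanced-paste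
      (balanced-flip (balanced-transpose (rectangle-balanced (A.x≤x∨y a a′) b≤b₀ d w)))
      (balanced-transpose (rectangle-balanced (A.y≤x∨y a a′) b≤b₀ d w)))

  lookup-α : ∀ d a b → lookup (F a b) (α d) ≡ lookup (F a b) d
  lookup-α d a b = proj₁ (proj₂ (from (a , b))) d

  all-balanced : ∀ d a a′ b b′ → BalancedAt d a a′ b b′
  all-balanced d a a′ b b′ with white (vert d) in w
  ... | true  = white-balanced d w a a′ b b′
  ... | false with white-balanced (α d) (black⇒white-α {G} d w) a a′ b b′
  ...   | r rewrite lookup-α d a b | lookup-α d a′ b | lookup-α d a b′ | lookup-α d a′ b′ = r

  Free₁ Free₂ : Dart G → Set
  Free₁ d = ∀ a a′ b → lookup (F a b) d ≡ lookup (F a′ b) d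
  Free₂ d = ∀ a b b′ → lookup (F a b) d ≡ lookup (F a b′) d

  -- The bits at `b` and `b′` differ by 1 or by -1, with the same sign for every first coordinate.
  -- Such a difference determines both bits, so the bit at `b` is constant in the first coordinate;
  -- balance carries this to every `y`.
  varying⇒Free₁ : ∀ d {c b b′} → lookup (F c b) d ≢ lookup (F c b′) d → Free₁ d
  varying⇒Free₁ d {c} {b} {b′} ne a a′ y = bit-injective (sym (+-cancelˡ-≡ (bitAt d a b) _ _ (begin
      bitAt d a b + bitAt d a′ y  ≡⟨ cross (all-balanced d a a′ b y) ⟩
      bitAt d a′ b + bitAt d a y  ≡⟨ cong (λ x → bit x + bitAt d a y) (trans (forced a′) (sym (forced a))) ⟩
      bitAt d a b + bitAt d a y   ∎)))
    where
    open ≡-Reasoning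
    extremal : ∀ {p q r s} → q ≢ s → Balanced (bit p) (bit q) (bit r) (bit s) → p ≡ q
    extremal {q = false} {s = false} ne _ = contradiction refl ne
    extremal {q = true}  {s = true}  ne _ = contradiction refl ne
    extremal {true}  {true}  {s = false} _ _ = refl
    extremal {false} {false} {s = true}  _ _ = refl
    extremal {false} {true}  {s = false} _ (balanced ())
    extremal {true}  {false} {true}  {true} _ (balanced ())
    extremal {true}  {false} {false} {true} _ (balanced ())

    forced : ∀ x → lookup (F x b) d ≡ lookup (F c b) d
    forced x = extremal ne (all-balanced d x c b b′)

  -- Otherwise `d′` would depend on the first coordinate only. Take `y` from a matching containing
  -- `d` and `x′` from one containing `d′`: then `F x′ y` contains both, two edges at one vertex.
  Free₁-vertex : Elementary G → ∀ d d′ → vert d ≡ vert d′ → Free₁ d → Free₁ d′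
  Free₁-vertex (_ , inMatching) d d′ eq free a a′ b with d ≟ d′
  ... | yes refl = free a a′ b
  ... | no d≢d′ with lookup (F a b) d′ Bool.≟ lookup (F a′ b) d′
  ...   | yes same = same
  ...   | no differ with inMatching d | inMatching d′
  ...     | M , pm , Md | M′ , pm′ , M′d′ with F-surjective M pm | F-surjective M′ pm′
  ...       | x , y , refl | x′ , y′ , refl =
    contradiction (trans (only d eq Fd) (sym (only d′ refl Fd′))) d≢d′
    where
    free₂ : Free₂ d′
    free₂ a b b′ with lookup (F a b) d′ Bool.≟ lookup (F a b′) d′
    ... | yes same = same
    -- Variation in the second coordinate would make `d′` free of the first, against `differ`.
    ... | no  ne   = contradiction (varying⇒Free₁ d′ ne _ _ _) differ

    Fd : lookup (F x′ y) d ≡ true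
    Fd = trans (free x′ x y) Md

    Fd′ : lookup (F x′ y) d′ ≡ true
    Fd′ = trans (free₂ x′ y y′) M′d′

    only : ∀ c → vert c ≡ vert d′ → lookup (F x′ y) c ≡ true → _ ≡ _
    only = proj₂ (proj₂ (proj₂ (proj₂ (proj₂ (from (x′ , y))) (vert d′))))

  Free₁-α : ∀ d → Free₁ d → Free₁ (α d)
  Free₁-α d free a a′ b = trans (lookup-α d a b) (trans (free a a′ b) (sym (lookup-α d a′ b)))

  -- There are finitely many darts and bits are decidable, so a witness is found by search.
  separating-dart : ∀ {a a′ b b′} → ¬ (a A.≈ a′ × b B.≈ b′) →
                    ∃[ d ] (lookup (F a b) d ≢ lookup (F a′ b′) d)
  separating-dart {a} {a′} {b} {b′} ne =
    ¬∀⟶∃¬ _ _ (λ d → lookup (F a b) d Bool.≟ lookup (F a′ b′) d)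
      λ same → ne (F-injective (lookup-injective same))

theorem3p6 : (G : PlaneBipartiteGraph) → Elementary G → MIrreducible G
theorem3p6 G el@(connected , _) L₁ L₂ _ (x , x′ , x≉x′) _ (y , y′ , y≉y′) I =
  -- `d` varies with the second coordinate, hence is free of the first; connectivity carries this to
  -- `d′`, which was chosen to vary with the first.
  let d  , varies₂ = separating-dart G connected I {x} {x} {y} {y′} λ eq → y≉y′ (proj₂ eq)
      d′ , varies₁ = separating-dart G connected I {x} {x′} {y} {y} λ eq → x≉x′ (proj₁ eq)
  in varies₁ (vertex-induction {G} connected (Free₁ G connected I) (Free₁-α G connected I)
       (Free₁-vertex G connected I el) d d′ (varying⇒Free₁ G connected I d varies₂) x x′ y)
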